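{- For every $k\ge 1$, there is an algorithm which, given a finite set $S\subseteq \mathcal{T}_k$, decides whether $(\operatorname{Forb}_\preceq(S),\preceq)$ has the joint embedding property. More generally, there is an algorithm which, given a (deterministic, bottom-up) tree automaton recognizing a tree language $L\subseteq\mathcal{T}_k$, decides whether $(L,\preceq)$ has the joint embedding property.
   Context: A "tree" means a finite, rooted, labeled binary tree (every vertex has either $0$ or $2$ children, children unordered), each vertex carrying a label from a finite label set; $\mathcal{T}_k$ is the set of such trees with $k$ possible labels. A tree $T$ contains $U$ topologically, written $U\preceq T$, if $U$ (including its root and labels) can be obtained from $T$ by a sequence of edge contractions and vertex/edge deletions, where the vertex resulting from contracting an edge gets the label of the parent endpoint; equivalently, there is an injection $\phi:V(U)\to V(T)$ such that the paths in $T$ from $\phi(u)$ to $\phi(v)$, $uv\in E(U)$, are edge-disjoint, contracting these paths to edges and deleting all vertices not on them yields $U$, and $v$ is a descendant of $u$ in $U$ iff $\phi(v)$ is a descendant of $\phi(u)$ in $T$. For a partially ordered set $(\mathcal{F},\le)$ and $S\subseteq\mathcal{F}$, $\operatorname{Forb}_\le(S)=\{X\in\mathcal{F}: Y\not\le X\text{ for all }Y\in S\}$. A poset $(\mathcal{F},\le)$ has the joint embedding property (JEP) if for all $X_1,X_2\in\mathcal{F}$ there is $Y\in\mathcal{F}$ with $X_1\le Y$ and $X_2\le Y$. A deterministic bottom-up tree automaton consists of a finite label set $\Lambda$, a finite state set $\Sigma$, accepting states $\Sigma_a\subseteq\Sigma$, and maps $m_0:\Lambda\to\Sigma$, $m_2:\Lambda\times\Sigma^2\to\Sigma$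 with $m_2(x,y,z)=m_2(x,z,y)$; it assigns to each vertex $u$ the state $m_0(\lambda_u)$ if $u$ is a leaf and $m_2(\lambda_u,\sigma(v_1),\sigma(v_2))$ if $u$ has children $v_1,v_2$ ($\lambda_u$ the label of $u$), and accepts the tree iff the root's state lies in $\Sigma_a$. It recognizes the language of trees it accepts; such languages are called regular tree languages. -}

module Defs where

open import Data.Nat using (ℕ)
open import Data.Fin using (Fin)
open import Data.Bool using (Bool; true)
open import Data.List using (List)
open import Data.List.Relation.Unary.All using (All)
open import Data.Product using (Σ; _×_)
open import Relation.Nullary using (¬_)
open import Relation.Binary.PropositionalEquality using (_≡_)

-- Finite rooted labeled binary trees with labels in Fin k
-- (every vertex has 0 or 2 children).  Children are written in some
-- order, but every notion below is invariant under swapping children,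
-- so trees are effectively unordered.
data Tree (k : ℕ) : Set where
  leaf : Fin k → Tree k
  node : Fin k → Tree k → Tree k → Tree k

label : ∀ {k} → Tree k → Fin k
label (leaf a)     = a
label (node a _ _) = a

-- Topological containment U ⪯ T: an injection φ : V(U) → V(T) preserving
-- labels, mapping edges to edge-disjoint downward paths, and respecting
-- the descendant relation.  Unfolded recursively on the structure of T:
--  * the image of U lies inside one child subtree of T, or
--  * the root of U is mapped to the root of T (same label); if U is a
--    node its two children's subtrees embed into the two distinct child
--    subtrees of T (in either order, children being unordered).
data _⪯_ {k : ℕ} : Tree k → Tree k → Set where
  inˡ   : ∀ {U a T₁ T₂} → U ⪯ T₁ → U ⪯ node a T₁ T₂
  inʳ   : ∀ {U a T₁ T₂} → U ⪯ T₂ → U ⪯ node a T₁ T₂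
  root  : ∀ {a T} → label T ≡ a → leaf a ⪯ T
  pair  : ∀ {a U₁ U₂ T₁ T₂} → U₁ ⪯ T₁ → U₂ ⪯ T₂ → node a U₁ U₂ ⪯ node a T₁ T₂
  cross : ∀ {a U₁ U₂ T₁ T₂} → U₁ ⪯ T₂ → U₂ ⪯ T₁ → node a U₁ U₂ ⪯ node a T₁ T₂

infix 4 _⪯_

Forb : ∀ {k} → List (Tree k) → Tree k → Set
Forb S X = All (λ Y → ¬ (Y ⪯ X)) S

JEP : ∀ {k} → (Tree k → Set) → Set
JEP {k} L = ∀ (X₁ X₂ : Tree k) → L X₁ → L X₂ →
  Σ (Tree k) (λ Y → L Y × (X₁ ⪯ Y) × (X₂ ⪯ Y))

record Automaton (k : ℕ) : Set where
  field
    states    : ℕ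
    accepting : Fin states → Bool
    m₀        : Fin k → Fin states
    m₂        : Fin k → Fin states → Fin states → Fin states
    m₂-sym    : ∀ x y z → m₂ x y z ≡ m₂ x z y

open Automaton public

run : ∀ {k} (A : Automaton k) → Tree k → Fin (states A)
run A (leaf a)       = m₀ A a
run A (node a T₁ T₂) = m₂ A a (run A T₁) (run A T₂)

Lang : ∀ {k} → Automaton k → Tree k → Set
Lang A T = accepting A (run A T) ≡ true

{-# OPTIONS --safe #-}
-- Let f be a map from trees to a finite set that is a congruence for the tree
-- constructors and saturates L.  Say that X is a pumping of Z if X arises from Z by
-- inserting, at vertices v, contexts that do not change the f-class of the subtree
-- at v.  The pumpings of a fixed Z are directed under ⪯: two contexts inserted at
-- the same vertex can be stacked.  Cutting out repetitions of classes
-- along branches shows that every tree is a pumping of a tree of height at most the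
-- number of classes.  So L is a finite union of directed sets, and it has the JEP
-- iff it is empty or one of them is cofinal in L.  Cofinality is decidable, because all the
-- predicates involved are saturated by finite congruences, and such a predicate is
-- satisfiable iff it holds of some tree of bounded height.
module Submission where

open import Defs
open import Data.Nat using (ℕ; zero; suc; _≤_; _*_; _^_; s≤s)
open import Data.Nat.Properties using (≤-trans; ≤-reflexive)
open import Data.Fin using (Fin; zero; suc; _≟_; combine; funToFin; finToFun)
open import Data.Fin.Properties using (combine-injective; finToFun-funToFin)
open import Data.Bool using (true)
import Data.Bool.Properties as Bool
open import Data.List using (List; []; _∷_; _++_; map; cartesianProductWith; allFin; filter; length)
open import Data.List.Properties using (filter-notAll; length-tabulate)
open import Data.List.Membership.Propositional using (_∈_; find; lose)
open import Data.List.Membership.Propositional.Properties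
  using (∈-map⁺; ∈-++⁺ˡ; ∈-++⁺ʳ; ∈-cartesianProductWith⁺; ∈-allFin; ∈-filter⁺; ∈-filter⁻)
open import Data.List.Relation.Unary.All as All using (All; []; _∷_)
open import Data.List.Relation.Unary.All.Properties using (¬All⇒Any¬)
open import Data.List.Relation.Unary.Any as Any using (Any)
open import Data.Empty using (⊥)
open import Data.Product as Prod using (∃; _×_; _,_; proj₁; proj₂)
open import Data.Sum as Sum using (_⊎_; inj₁; inj₂)
open import Data.Unit using (⊤; tt)
open import Function using (_∘_)
open import Function.Bundles using (_⇔_; mk⇔; Equivalence)
open import Relation.Nullary using (Dec; yes; no; ¬_; contradiction; ¬?; _×-dec_; _⊎-dec_)
open import Relation.Nullary.Decidable using (map′; decidable-stable)
open import Relation.Unary using (Decidable)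
open import Relation.Binary.PropositionalEquality using (_≡_; refl; sym; trans; cong; cong₂)

open Equivalence using (to; from)

-- Topological containment as a preorder.

⪯-refl : ∀ {k} (T : Tree k) → T ⪯ T
⪯-refl (leaf a)     = root refl
⪯-refl (node a T U) = pair (⪯-refl T) (⪯-refl U)

⪯-trans : ∀ {k} {U V W : Tree k} → U ⪯ V → V ⪯ W → U ⪯ W
⪯-trans p           (inˡ q)       = inˡ (⪯-trans p q)
⪯-trans p           (inʳ q)       = inʳ (⪯-trans p q)
⪯-trans (root refl) (root q)      = root q
⪯-trans (inˡ p)     (pair q₁ q₂)  = inˡ (⪯-trans p q₁)
⪯-trans (inʳ p)     (pair q₁ q₂)  = inʳ (⪯-trans p q₂)
⪯-trans (root refl) (pair q₁ q₂)  = root refl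
⪯-trans (pair p r)  (pair q₁ q₂)  = pair (⪯-trans p q₁) (⪯-trans r q₂)
⪯-trans (cross p r) (pair q₁ q₂)  = cross (⪯-trans p q₂) (⪯-trans r q₁)
⪯-trans (inˡ p)     (cross q₁ q₂) = inʳ (⪯-trans p q₁)
⪯-trans (inʳ p)     (cross q₁ q₂) = inˡ (⪯-trans p q₂)
⪯-trans (root refl) (cross q₁ q₂) = root refl
⪯-trans (pair p r)  (cross q₁ q₂) = cross (⪯-trans p q₁) (⪯-trans r q₂)
⪯-trans (cross p r) (cross q₁ q₂) = pair (⪯-trans p q₂) (⪯-trans r q₁)

-- Enumeration of the trees of bounded height.

trees : ∀ {k} → ℕ → List (Tree k)
-- Height counts vertices, so no tree has height `zero`.
trees         zero    = []
trees {k = k} (suc n) =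
  map leaf (allFin k) ++
  cartesianProductWith (λ a (T , U) → node a T U) (allFin k)
    (cartesianProductWith _,_ (trees n) (trees n))

leaf∈trees : ∀ {k n} (a : Fin k) → leaf a ∈ trees (suc n)
leaf∈trees a = ∈-++⁺ˡ (∈-map⁺ leaf (∈-allFin a))

node∈trees : ∀ {k n} (a : Fin k) {T U} → T ∈ trees n → U ∈ trees n → node a T U ∈ trees (suc n)
node∈trees {k} a T∈ U∈ =
  ∈-++⁺ʳ (map leaf (allFin k))
    (∈-cartesianProductWith⁺ (λ a (T , U) → node a T U) (∈-allFin a)
      (∈-cartesianProductWith⁺ _,_ T∈ U∈))

-- Finite congruences, pumpings and reducts.

record Congruence (k : ℕ) : Set where
  field
    size  : ℕ
    class : Tree k → Fin size
    class-node : ∀ {a T T′ U U′} → class T ≡ class T′ → class U ≡ class U′ →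
                 class (node a T U) ≡ class (node a T′ U′)

module Pumping {k : ℕ} (C : Congruence k) where
  open Congruence C

  -- Some subtree of the right-hand tree is a pumping of the left-hand one; hence the
  -- whole tree is one iff in addition the two trees have the same class.
  data _⊑_ : Tree k → Tree k → Set where
    leaf : ∀ {a} → leaf a ⊑ leaf a
    node : ∀ {a Z₁ Z₂ X₁ X₂} → class X₁ ≡ class Z₁ → Z₁ ⊑ X₁ → class X₂ ≡ class Z₂ → Z₂ ⊑ X₂ →
           node a Z₁ Z₂ ⊑ node a X₁ X₂
    inˡ  : ∀ {Z a X₁ X₂} → Z ⊑ X₁ → Z ⊑ node a X₁ X₂
    inʳ  : ∀ {Z a X₁ X₂} → Z ⊑ X₂ → Z ⊑ node a X₁ X₂

  infix 4 _⊑_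

  ⊑⇒⪯ : ∀ {Z X} → Z ⊑ X → Z ⪯ X
  ⊑⇒⪯ leaf           = root refl
  ⊑⇒⪯ (node _ p _ q) = pair (⊑⇒⪯ p) (⊑⇒⪯ q)
  ⊑⇒⪯ (inˡ p)        = inˡ (⊑⇒⪯ p)
  ⊑⇒⪯ (inʳ p)        = inʳ (⊑⇒⪯ p)

  Join : Fin size → (Z X X′ : Tree k) → Set
  Join c Z X X′ = ∃ λ Y → class Y ≡ c × Z ⊑ Y × X ⪯ Y × X′ ⪯ Y

  -- The contexts of X are placed above those of X′; they fit since class X′ ≡ class Z.
  mutual
    directed : ∀ {Z X X′} → Z ⊑ X → class X′ ≡ class Z → Z ⊑ X′ → Join (class X) Z X X′
    directed leaf e q = _ , e , q , ⊑⇒⪯ q , ⪯-refl _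
    directed (node e₁ p₁ e₂ p₂) e q =
      let Y , eY , z , x , x′ = directed-node e₁ p₁ e₂ p₂ q
      in Y , trans eY (trans e (sym (class-node e₁ e₂))) , z , x , x′
    directed (inˡ p) e q =
      let Y , eY , z , x , x′ = directed p e q
      in node _ Y _ , class-node eY refl , inˡ z , pair x (⪯-refl _) , inˡ x′
    directed (inʳ p) e q =
      let Y , eY , z , x , x′ = directed p e q
      in node _ _ Y , class-node refl eY , inʳ z , pair (⪯-refl _) x , inʳ x′

    -- With the contexts of `X` at this vertex used up, those of `X′` are peeled off in turn, which
    -- gives the join the class of `X′`. Where the two roots match, the children are joined
    -- separately.
    directed-node : ∀ {a Z₁ Z₂ X₁ X₂ X′} →
                    class X₁ ≡ class Z₁ → Z₁ ⊑ X₁ → class X₂ ≡ class Z₂ → Z₂ ⊑ X₂ →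
                    node a Z₁ Z₂ ⊑ X′ → Join (class X′) (node a Z₁ Z₂) (node a X₁ X₂) X′
    directed-node e₁ p₁ e₂ p₂ (node e₁′ q₁ e₂′ q₂) =
      let Y₁ , eY₁ , z₁ , x₁ , x₁′ = directed p₁ e₁′ q₁
          Y₂ , eY₂ , z₂ , x₂ , x₂′ = directed p₂ e₂′ q₂
          eZ₁ = trans eY₁ e₁
          eZ₂ = trans eY₂ e₂
      in node _ Y₁ Y₂ , class-node (trans eZ₁ (sym e₁′)) (trans eZ₂ (sym e₂′)) ,
         node eZ₁ z₁ eZ₂ z₂ , pair x₁ x₂ , pair x₁′ x₂′
    directed-node e₁ p₁ e₂ p₂ (inˡ q) =
      let Y , eY , z , x , x′ = directed-node e₁ p₁ e₂ p₂ q
      in node _ Y _ , class-node eY refl , inˡ z , inˡ x , pair x′ (⪯-refl _)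
    directed-node e₁ p₁ e₂ p₂ (inʳ q) =
      let Y , eY , z , x , x′ = directed-node e₁ p₁ e₂ p₂ q
      in node _ _ Y , class-node refl eY , inʳ z , inʳ x , pair (⪯-refl _) x′

  mutual
    Within : List (Fin size) → Tree k → Set
    Within R T = class T ∈ R × ChildrenWithin R T

    -- The root is exempt, so that for `V` of class `c`, `ChildrenWithin (remove c R) V` puts the
    -- only occurrence of `c` in `V` at its root.
    ChildrenWithin : List (Fin size) → Tree k → Set
    ChildrenWithin R (leaf a)     = ⊤
    ChildrenWithin R (node a T U) = Within R T × Within R U

  within-allFin : ∀ T → Within (allFin size) T
  within-allFin (leaf a)     = ∈-allFin _ , tt
  within-allFin (node a T U) = ∈-allFin _ , within-allFin T , within-allFin U

  remove : Fin size → List (Fin size) → List (Fin size)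
  remove c = filter (λ d → ¬? (d ≟ c))

  -- That `V` is a subtree of `X` is recorded only through its effect on `⊑`.
  Deepest : List (Fin size) → Fin size → Tree k → Set
  Deepest R c X = ∃ λ V → (∀ {Z} → Z ⊑ V → Z ⊑ X) × class V ≡ c × ChildrenWithin (remove c R) V

  -- The root is tested only after both children are known to avoid `c`, so an occurrence that is
  -- found has none below it.
  deepest : ∀ {R} c X → Within R X → Within (remove c R) X ⊎ Deepest R c X
  deepest-here : ∀ {R} c X → class X ∈ R → ChildrenWithin (remove c R) X →
                 Within (remove c R) X ⊎ Deepest R c X
  deepest-here c X X∈ w with class X ≟ c
  ... | yes e = inj₂ (X , (λ z → z) , e , w)
  ... | no ne = inj₁ (∈-filter⁺ (λ d → ¬? (d ≟ c)) X∈ ne , w)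

  deepest c (leaf a) (X∈ , _) = deepest-here c (leaf a) X∈ tt
  deepest c (node a T U) (X∈ , wT , wU) with deepest c T wT | deepest c U wU
  ... | inj₂ (V , up , d) | _                 = inj₂ (V , inˡ ∘ up , d)
  ... | inj₁ _            | inj₂ (V , up , d) = inj₂ (V , inʳ ∘ up , d)
  ... | inj₁ w₁           | inj₁ w₂           = deepest-here c (node a T U) X∈ (w₁ , w₂)

  Reduct : ℕ → Tree k → Set
  Reduct n X = ∃ λ Z → Z ∈ trees n × class X ≡ class Z × Z ⊑ X

  -- X is cut down to the subtree at a deepest occurrence of the class of its root,
  -- so that this class does not occur further below.
  reduct-within : ∀ n R X → length R ≤ n → Within R X → Reduct n X
  reduct-within zero    []      X _  (() , _)
  reduct-within (suc n) R X le w@(X∈ , _) with deepest (class X) X w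
  -- `class X` occurs in `X` at the root, so it cannot be avoided.
  ... | inj₁ (X∈′ , _) = contradiction refl (proj₂ (∈-filter⁻ (λ d → ¬? (d ≟ class X)) {xs = R} X∈′))
  ... | inj₂ (leaf a , up , e , _) = leaf a , leaf∈trees {n = n} a , sym e , up leaf
  ... | inj₂ (node a T U , up , e , wT , wU)
    -- `class X` lies in `R`, so removing it shortens the list and the bound `n` suffices for the
    -- children.
    with s≤s le′ ← ≤-trans (filter-notAll (λ d → ¬? (d ≟ class X)) R (Any.map (λ x≡y ne → ne (sym x≡y)) X∈)) le
    with Z₁ , Z₁∈ , e₁ , z₁ ← reduct-within n _ T le′ wT
    with Z₂ , Z₂∈ , e₂ , z₂ ← reduct-within n _ U le′ wU =
      node a Z₁ Z₂ , node∈trees {n = n} a Z₁∈ Z₂∈ , trans (sym e) (class-node e₁ e₂) ,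
      up (node e₁ z₁ e₂ z₂)

  reduct : ∀ X → Reduct size X
  reduct X = reduct-within size (allFin size) X (≤-reflexive (length-tabulate (λ i → i))) (within-allFin X)

-- Regular predicates in Myhill-Nerode form: decidable unions of classes of a finite congruence.

record Regular {k : ℕ} (P : Tree k → Set) : Set where
  field
    congruence : Congruence k
  open Congruence congruence public
  field
    respects : ∀ {T U} → class T ≡ class U → P T → P U
    decide   : Decidable P

open Regular using (decide)

-- Each tree has a reduct of its own class in `trees size`, so searching this finite list is enough.
satisfiable? : ∀ {k} {P : Tree k → Set} → Regular P → Dec (∃ P)
satisfiable? {P = P} r = map′ Any.satisfied small (Any.any? (decide r) (trees size))
  where
  open Regular r using (congruence; size; respects)
  small : ∃ P → Any P (trees size)
  small (X , PX) =
    let Z , Z∈ , e , _ = Pumping.reduct congruence X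
    in lose Z∈ (respects e PX)

_⊗_ : ∀ {k} → Congruence k → Congruence k → Congruence k
C ⊗ D = record
  { size  = C.size * D.size
  ; class = λ T → combine (C.class T) (D.class T)
  ; class-node = λ {a} {T} {T′} {U} {U′} e e′ →
      let p , q   = combine-injective _ (D.class T) _ _ e
          p′ , q′ = combine-injective _ (D.class U) _ _ e′
      in cong₂ combine (C.class-node p p′) (D.class-node q q′)
  }
  where
  module C = Congruence C
  module D = Congruence D

∩-regular : ∀ {k} {P Q : Tree k → Set} → Regular P → Regular Q → Regular (λ T → P T × Q T)
∩-regular p q = record
  { congruence = p.congruence ⊗ q.congruence
  ; respects   = λ {T} {U} e (PT , QT) →
      let e₁ , e₂ = combine-injective (p.class T) (q.class T) (p.class U) (q.class U) e
      in p.respects e₁ PT , q.respects e₂ QT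
  ; decide     = λ T → p.decide T ×-dec q.decide T
  }
  where
  module p = Regular p
  module q = Regular q

∁-regular : ∀ {k} {P : Tree k → Set} → Regular P → Regular (¬_ ∘ P)
∁-regular r = record
  { congruence = congruence
  ; respects   = λ e ¬PT PU → ¬PT (respects (sym e) PU)
  ; decide     = λ T → ¬? (Regular.decide r T)
  }
  where open Regular r using (congruence; respects)

class-regular : ∀ {k} (C : Congruence k) c → Regular (λ T → Congruence.class C T ≡ c)
class-regular C c = record
  { congruence = C
  ; respects   = λ e e′ → trans (sym e) e′
  ; decide     = λ T → Congruence.class C T ≟ c
  }

trivial : ∀ {k} → Congruence k
trivial = record { size = 1 ; class = λ _ → zero ; class-node = λ _ _ → refl }

⊤-regular : ∀ {k} → Regular {k} (λ _ → ⊤)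
⊤-regular = record { congruence = trivial ; respects = λ _ _ → tt ; decide = λ _ → yes tt }

regular-resp-⇔ : ∀ {k} {P Q : Tree k → Set} → (∀ {T} → P T → Q T) → (∀ {T} → Q T → P T) →
            Regular P → Regular Q
regular-resp-⇔ f g r = record
  { congruence = congruence
  ; respects   = λ e → f ∘ respects e ∘ g
  ; decide     = λ T → map′ f g (Regular.decide r T)
  }
  where open Regular r using (congruence; respects)

-- Regularity of containment and of pumping.

bit : ∀ {P : Set} → Dec P → Fin 2
bit (no _)  = zero
bit (yes _) = suc zero

bit-injective : ∀ {P Q : Set} (p? : Dec P) (q? : Dec Q) → bit p? ≡ bit q? → P → Q
bit-injective _       (yes q) _  _ = q
bit-injective (no ¬p) (no _)  _  p = contradiction p ¬p
bit-injective (yes _) (no _)  () _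

bit-cong : ∀ {P Q : Set} (p? : Dec P) (q? : Dec Q) → (P → Q) → (Q → P) → bit p? ≡ bit q?
bit-cong (yes _) (yes _) _ _ = refl
bit-cong (no _)  (no _)  _ _ = refl
bit-cong (yes p) (no ¬q) f _ = contradiction (f p) ¬q
bit-cong (no ¬p) (yes q) _ g = contradiction (g q) ¬p

-- The class is refined by one bit, the truth value of `P`. At a node, the root condition `R`
-- depends on the classes of the children and the rest of the unfolding on their bits.
somewhere-regular :
  ∀ {k} {P : Tree k → Set} {R : Fin k → Tree k → Tree k → Set} (C : Congruence k) →
  let open Congruence C in
  (∀ a → Dec (P (leaf a))) →
  (∀ {a T U} → P (node a T U) ⇔ (R a T U ⊎ P T ⊎ P U)) →
  (∀ a T U → Dec (R a T U)) →
  (∀ {a T T′ U U′} → class T ≡ class T′ → class U ≡ class U′ → R a T U → R a T′ U′) →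
  Regular P
somewhere-regular {P = P} C leaf? unfold R? R-resp = record
  { congruence = record
    { size  = size * 2
    ; class = λ T → combine (class T) (bit (P? T))
    ; class-node = λ {a} {T} {T′} {U} {U′} e e′ →
        let p , q   = combine-injective (class T) (bit (P? T)) (class T′) (bit (P? T′)) e
            p′ , q′ = combine-injective (class U) (bit (P? U)) (class U′) (bit (P? U′)) e′
        in cong₂ combine (class-node p p′)
             (bit-cong (P? (node a T U)) (P? (node a T′ U′))
               (transfer p q p′ q′) (transfer (sym p) (sym q) (sym p′) (sym q′)))
    }
  ; respects = λ {T} {U} e →
      bit-injective (P? T) (P? U)
        (proj₂ (combine-injective (class T) (bit (P? T)) (class U) (bit (P? U)) e))
  ; decide = P?
  }
  where
  open Congruence C
  P? : Decidable P
  P? (leaf a)     = leaf? a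
  P? (node a T U) = map′ (from unfold) (to unfold) (R? a T U ⊎-dec (P? T ⊎-dec P? U))
  transfer : ∀ {a T T′ U U′} → class T ≡ class T′ → bit (P? T) ≡ bit (P? T′) →
             class U ≡ class U′ → bit (P? U) ≡ bit (P? U′) → P (node a T U) → P (node a T′ U′)
  transfer {T = T} {T′} {U} {U′} p q p′ q′ x with to unfold x
  ... | inj₁ r        = from unfold (inj₁ (R-resp p p′ r))
  ... | inj₂ (inj₁ y) = from unfold (inj₂ (inj₁ (bit-injective (P? T) (P? T′) q y)))
  ... | inj₂ (inj₂ y) = from unfold (inj₂ (inj₂ (bit-injective (P? U) (P? U′) q′ y)))

-- By recursion on the contained tree: besides the label, a match at the root depends only on which
-- of `X₁` and `X₂` each child contains.
⪯-regular : ∀ {k} (X : Tree k) → Regular (X ⪯_)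
⪯-regular (leaf a) = somewhere-regular {R = λ b _ _ → b ≡ a} trivial
  (λ b → map′ root (λ { (root e) → e }) (b ≟ a))
  (mk⇔ (λ { (root e) → inj₁ e ; (inˡ x) → inj₂ (inj₁ x) ; (inʳ x) → inj₂ (inj₂ x) })
       (λ { (inj₁ e) → root e ; (inj₂ (inj₁ x)) → inˡ x ; (inj₂ (inj₂ x)) → inʳ x }))
  (λ b _ _ → b ≟ a)
  (λ _ _ e → e)
⪯-regular {k} (node a X₁ X₂) = somewhere-regular {R = Split} (r₁.congruence ⊗ r₂.congruence)
  (λ b → no λ ())
  (mk⇔ (λ { (pair x y)  → inj₁ (refl , inj₁ (x , y))
          ; (cross x y) → inj₁ (refl , inj₂ (x , y))
          ; (inˡ x)     → inj₂ (inj₁ x)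
          ; (inʳ x)     → inj₂ (inj₂ x) })
       (λ { (inj₁ (refl , inj₁ (x , y))) → pair x y
          ; (inj₁ (refl , inj₂ (x , y))) → cross x y
          ; (inj₂ (inj₁ x))              → inˡ x
          ; (inj₂ (inj₂ x))              → inʳ x }))
  (λ b T U → (b ≟ a) ×-dec
    ((r₁.decide T ×-dec r₂.decide U) ⊎-dec (r₁.decide U ×-dec r₂.decide T)))
  Split-respects
  where
  module r₁ = Regular (⪯-regular X₁)
  module r₂ = Regular (⪯-regular X₂)
  open Congruence (r₁.congruence ⊗ r₂.congruence) using (class)
  Split : Fin k → Tree k → Tree k → Set
  Split b T U = b ≡ a × ((X₁ ⪯ T × X₂ ⪯ U) ⊎ (X₁ ⪯ U × X₂ ⪯ T))
  Split-respects : ∀ {b T T′ U U′} → class T ≡ class T′ → class U ≡ class U′ →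
                   Split b T U → Split b T′ U′
  Split-respects {T = T} {T′} {U} {U′} e e′ (b≡a , s) =
    let p , q   = combine-injective (r₁.class T) (r₂.class T) (r₁.class T′) (r₂.class T′) e
        p′ , q′ = combine-injective (r₁.class U) (r₂.class U) (r₁.class U′) (r₂.class U′) e′
    in b≡a , Sum.map (Prod.map (r₁.respects p) (r₂.respects q′))
                     (Prod.map (r₁.respects p′) (r₂.respects q)) s

⊑-regular : ∀ {k} (C : Congruence k) (Z : Tree k) → Regular (Pumping._⊑_ C Z)
-- Mutual with `⊑-regular`, since a match at a node requires the children to be pumpings, classes
-- included.
pumping-regular : ∀ {k} (C : Congruence k) (Z : Tree k) →
  Regular (λ X → Congruence.class C X ≡ Congruence.class C Z × Pumping._⊑_ C Z X)
pumping-regular C Z = ∩-regular (class-regular C (Congruence.class C Z)) (⊑-regular C Z)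

⊑-regular C (leaf a) = somewhere-regular {R = λ _ _ _ → ⊥} trivial
  (λ b → map′ (λ { refl → leaf }) (λ { leaf → refl }) (b ≟ a))
  (mk⇔ (λ { (inˡ x) → inj₂ (inj₁ x) ; (inʳ x) → inj₂ (inj₂ x) })
       (λ { (inj₁ ()) ; (inj₂ (inj₁ x)) → inˡ x ; (inj₂ (inj₂ x)) → inʳ x }))
  (λ _ _ _ → no λ ())
  (λ _ _ e → e)
  where open Pumping C
⊑-regular {k} C (node a Z₁ Z₂) = somewhere-regular {R = Match} (r₁.congruence ⊗ r₂.congruence)
  (λ b → no λ ())
  (mk⇔ (λ { (node e x e′ y) → inj₁ (refl , (e , x) , (e′ , y))
          ; (inˡ x)         → inj₂ (inj₁ x)
          ; (inʳ x)         → inj₂ (inj₂ x) })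
       (λ { (inj₁ (refl , (e , x) , (e′ , y))) → node e x e′ y
          ; (inj₂ (inj₁ x))                    → inˡ x
          ; (inj₂ (inj₂ x))                    → inʳ x }))
  (λ b T U → (b ≟ a) ×-dec (r₁.decide T ×-dec r₂.decide U))
  Match-respects
  where
  open Pumping C
  module r₁ = Regular (pumping-regular C Z₁)
  module r₂ = Regular (pumping-regular C Z₂)
  open Congruence (r₁.congruence ⊗ r₂.congruence) using (class)
  open Congruence C using () renaming (class to classᶜ)
  Match : Fin k → Tree k → Tree k → Set
  Match b T U = b ≡ a × (classᶜ T ≡ classᶜ Z₁ × Z₁ ⊑ T) × (classᶜ U ≡ classᶜ Z₂ × Z₂ ⊑ U)
  Match-respects : ∀ {b T T′ U U′} → class T ≡ class T′ → class U ≡ class U′ →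
                   Match b T U → Match b T′ U′
  Match-respects {T = T} {T′} {U} {U′} e e′ (b≡a , x , y) =
    b≡a , r₁.respects (proj₁ (combine-injective (r₁.class T) (r₂.class T) (r₁.class T′) (r₂.class T′) e)) x
        , r₂.respects (proj₂ (combine-injective (r₁.class U) (r₂.class U) (r₁.class U′) (r₂.class U′) e′)) y

-- Downward closures of regular predicates.

↓ : ∀ {k} → (Tree k → Set) → Tree k → Set
↓ P X = ∃ λ Y → P Y × X ⪯ Y

↓-closed : ∀ {k} {P : Tree k → Set} {T U} → T ⪯ U → ↓ P U → ↓ P T
↓-closed p (Y , PY , q) = Y , PY , ⪯-trans p q

-- X is classified by the set of the classes of trees that contain X.
↓-regular : ∀ {k} {P : Tree k → Set} → Regular P → Regular (↓ P)
↓-regular {k} {P} r = record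
  { congruence = record
    { size  = 2 ^ size
    ; class = λ X → funToFin (λ c → bit (above? c X))
    ; class-node = λ {a} {T} {T′} {U} {U′} e e′ → funToFin-cong λ c →
        bit-cong (above? c (node a T U)) (above? c (node a T′ U′))
          (λ (Y , Y≡c , x) → let Y′ , e″ , x′ = replace (above⇒ e) (above⇒ e′) x in Y′ , trans e″ Y≡c , x′)
          (λ (Y , Y≡c , x) → let Y′ , e″ , x′ = replace (above⇒ (sym e)) (above⇒ (sym e′)) x in Y′ , trans e″ Y≡c , x′)
    }
  ; respects = λ e (Y , PY , x) → let Y′ , e′ , x′ = above⇒ e x in Y′ , respects (sym e′) PY , x′
  ; decide   = λ X → satisfiable? (∩-regular r (⪯-regular X))
  }
  where
  open Regular r using (congruence; size; class; class-node; respects)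

  Above : Fin size → Tree k → Set
  Above c X = ∃ λ Y → class Y ≡ c × X ⪯ Y

  above? : ∀ c X → Dec (Above c X)
  above? c X = satisfiable? (∩-regular (class-regular congruence c) (⪯-regular X))

  funToFin-cong : ∀ {m n} {f g : Fin m → Fin n} → (∀ i → f i ≡ g i) → funToFin f ≡ funToFin g
  funToFin-cong {zero}  _ = refl
  funToFin-cong {suc m} e = cong₂ combine (e zero) (funToFin-cong (e ∘ suc))

  above⇒ : ∀ {X X′} → funToFin (λ c → bit (above? c X)) ≡ funToFin (λ c → bit (above? c X′)) →
           ∀ {Y} → X ⪯ Y → Above (class Y) X′
  above⇒ {X} {X′} e {Y} x =
    bit-injective (above? (class Y) X) (above? (class Y) X′)
      -- Decoding both codes at the index `class Y` isolates the bit of that class.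
      (trans (sym (finToFun-funToFin (λ c → bit (above? c X)) (class Y)))
        (trans (cong (λ i → finToFun {m = 2} {size} i (class Y)) e)
          (finToFun-funToFin (λ c → bit (above? c X′)) (class Y))))
      (Y , refl , x)

  -- Where the children `X₁` and `X₂` embed in `Y`, trees of the same classes containing `X₁′` and
  -- `X₂′` are substituted; the congruence keeps the class of the whole.
  replace : ∀ {a X₁ X₂ X₁′ X₂′} →
            (∀ {Y} → X₁ ⪯ Y → Above (class Y) X₁′) → (∀ {Y} → X₂ ⪯ Y → Above (class Y) X₂′) →
            ∀ {Y} → node a X₁ X₂ ⪯ Y → Above (class Y) (node a X₁′ X₂′)
  replace f g (inˡ x) =
    let Y , e , x′ = replace f g x in node _ Y _ , class-node e refl , inˡ x′
  replace f g (inʳ x) =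
    let Y , e , x′ = replace f g x in node _ _ Y , class-node refl e , inʳ x′
  replace f g (pair x y) =
    let Y₁ , e₁ , x′ = f x
        Y₂ , e₂ , y′ = g y
    in node _ Y₁ Y₂ , class-node e₁ e₂ , pair x′ y′
  replace f g (cross x y) =
    let Y₂ , e₂ , x′ = f x
        Y₁ , e₁ , y′ = g y
    in node _ Y₁ Y₂ , class-node e₁ e₂ , cross x′ y′

-- Deciding joint embedding for a regular predicate.

module _ {k : ℕ} {L : Tree k → Set} (r : Regular L) where
  open Regular r using (congruence; size; class; respects)
  open Pumping congruence

  -- Since `L` is saturated, `L Y` here amounts to `L Z`. For `Z` outside `L` nothing qualifies, so
  -- all of `trees size` can be tested without filtering by `L`.
  Pumpings : Tree k → Tree k → Set
  Pumpings Z Y = L Y × class Y ≡ class Z × Z ⊑ Y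

  ↓-pumpings-regular : ∀ Z → Regular (↓ (Pumpings Z))
  ↓-pumpings-regular Z = ↓-regular (∩-regular r (pumping-regular congruence Z))

  -- Failure of cofinality, with a witness that `common-escape` can embed further.
  Escapes : Tree k → Set
  Escapes Z = ∃ λ X → L X × ¬ ↓ (Pumpings Z) X

  escapes? : Decidable Escapes
  escapes? Z = satisfiable? (∩-regular r (∁-regular (↓-pumpings-regular Z)))

  -- Both trees lie below pumpings of the same `Z`; these have an upper bound in the class of the
  -- first, hence in `L`.
  cofinal⇒JEP : ∀ {Z} → ¬ Escapes Z → JEP L
  cofinal⇒JEP {Z} ¬esc X₁ X₂ LX₁ LX₂ =
    let Y₁ , (LY₁ , _ , z₁)  , x₁ = below X₁ LX₁
        Y₂ , (_   , e₂ , z₂) , x₂ = below X₂ LX₂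
        Y , e , _ , y₁ , y₂       = directed z₁ e₂ z₂
    in Y , respects (sym e) LY₁ , ⪯-trans x₁ y₁ , ⪯-trans x₂ y₂
    where
    below : ∀ X → L X → ↓ (Pumpings Z) X
    below X LX = decidable-stable (decide (↓-pumpings-regular Z) X) λ ¬b → ¬esc (X , LX , ¬b)

  -- Joint embedding merges the witnesses one at a time; escaping persists upwards because each
  -- `↓ (Pumpings Z)` is downward closed.
  common-escape : JEP L → ∃ L → ∀ {Zs} → All Escapes Zs →
                  ∃ λ W → L W × All (λ Z → ¬ ↓ (Pumpings Z) W) Zs
  common-escape jep (X , LX) [] = X , LX , []
  common-escape jep X₀ ((X , LX , ¬X) ∷ es) =
    let V , LV , ¬V    = common-escape jep X₀ es
        W , LW , x , v = jep X V LX LV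
    in W , LW , ¬X ∘ ↓-closed x ∷ All.map (_∘ ↓-closed v) ¬V

  JEP? : Dec (JEP L)
  JEP? with satisfiable? r
  ... | no empty = yes λ X _ LX → contradiction (X , LX) empty
  ... | yes X₀ with All.all? escapes? (trees size)
  ...   | no ¬all = let Z , _ , ¬esc = find (¬All⇒Any¬ escapes? (trees size) ¬all)
                    in yes (cofinal⇒JEP {Z} ¬esc)
  -- A tree `W` escaping every candidate would escape its own reduct `Z`, of which it is a pumping.
  ...   | yes all = no λ jep →
    let W , LW , ¬W    = common-escape jep X₀ all
        Z , Z∈ , e , z = reduct W
    in All.lookup ¬W Z∈ (W , (LW , e , z) , ⪯-refl W)

-- The two instances: forbidden trees and automata.

Forb-regular : ∀ {k} (S : List (Tree k)) → Regular (Forb S)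
Forb-regular []      = regular-resp-⇔ (λ _ → []) (λ _ → tt) ⊤-regular
Forb-regular (Y ∷ S) =
  regular-resp-⇔ (λ (n , ns) → n ∷ ns) (λ { (n ∷ ns) → n , ns })
    (∩-regular (∁-regular (⪯-regular Y)) (Forb-regular S))

Lang-regular : ∀ {k} (A : Automaton k) → Regular (Lang A)
Lang-regular A = record
  { congruence = record
    { size       = states A
    ; class      = run A
    ; class-node = λ {a} → cong₂ (m₂ A a)
    }
  ; respects = λ e acc → trans (cong (accepting A) (sym e)) acc
  ; decide   = λ T → accepting A (run A T) Bool.≟ true
  }

theorem1 : (k : ℕ) → 1 ≤ k →
    ((S : List (Tree k)) → Dec (JEP (Forb S))) ×
    ((A : Automaton k) → Dec (JEP (Lang A)))
theorem1 k _ = (λ S → JEP? (Forb-regular S)) , (λ A → JEP? (Lang-regular A))
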